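{- Let $G$ be a finite simple graph, let $f:V(G)\rightarrow\mathbb{Z}^+$ be an even integer-valued function with $f(v)\geq 4$ for all $v$, and let $H_f(v)=\{1,3,\ldots,f(v)-1,f(v)\}$. Let $(A_{H_f},B_{H_f},C_{H_f},D_{H_f})$ be the $H_f$-decomposition of $G$. Then (a) $E_G(B_{H_f},B_{H_f}\cup C_{H_f})=\emptyset$; (b) for every component $R$ of $G[D_{H_f}]$, $|V(R)|+|E_G(V(R),B_{H_f})|\equiv 1\pmod 2$; (c) every component of $G[D_{H_f}\cup B_{H_f}]$ has odd order.
   Context: For a set function $H$ on $G$ (assigning a set of nonnegative integers to each vertex), let $\nabla_H(F)=\sum_{v}\min\{|d_F(v)-h|: h\in H(v)\}$ for spanning subgraphs $F$, $\nabla(H)$ its minimum over spanning subgraphs, and $F$ is $H$-optimal if $\nabla_H(F)=\nabla(H)$. Let $I_H(v)=\{d_F(v): F\ H\text{ -optimal}\}$, $MH(v)=\max H(v)$, $mH(v)=\min H(v)$. The $H$-decomposition is $C_H=\{v: I_H(v)\subseteq H(v)\}$, $A_H=\{v\notin C_H: \min I_H(v)\geq MH(v)\}$, $B_H=\{v\notin C_H:\max I_H(v)\leq mH(v)\}$, $D_H=V(G)\setminus(A_H\cup B_H\cup C_H)$. $E_G(S,T)$ denotes the set of edges with one end in $S$ and the other in $T$. -}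

module Defs where

open import Data.Nat.Base using (ℕ; zero; suc; _+_; _*_; _≤_; _⊔_; _⊓_; ∣_-_∣; ⌊_/2⌋)
open import Data.Bool.Base using (Bool; true; false; if_then_else_; _∨_)
open import Data.Fin.Base using (Fin)
open import Data.List.Base using (List; []; _∷_; map; foldr; upTo; allFin; _++_)
open import Data.Nat.ListAction using (sum)
open import Data.List.Membership.Propositional using (_∈_)
open import Data.Product.Base using (Σ; _×_; ∃)
open import Relation.Binary.PropositionalEquality using (_≡_)
open import Relation.Nullary.Negation using (¬_)
open import Data.Sum.Base using (_⊎_)

record Graph (n : ℕ) : Set where
  field
    adj    : Fin n → Fin n → Bool
    sym    : ∀ u v → adj u v ≡ adj v u
    irrefl : ∀ v → adj v v ≡ false
open Graph public

record Spanning {n : ℕ} (G : Graph n) : Set where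
  field
    sub    : Fin n → Fin n → Bool
    subSym : ∀ u v → sub u v ≡ sub v u
    subAdj : ∀ u v → sub u v ≡ true → adj G u v ≡ true
open Spanning public

indicator : Bool → ℕ
indicator true  = 1
indicator false = 0

count : {n : ℕ} → (Fin n → Bool) → ℕ
count {n} P = sum (map (λ u → indicator (P u)) (allFin n))

deg : {n : ℕ} {G : Graph n} → Spanning G → Fin n → ℕ
deg F v = count (λ u → sub F v u)

-- Set functions: each vertex gets a finite (nonempty) set of naturals,
-- represented as a list.

SetFun : ℕ → Set
SetFun n = Fin n → List ℕ

maxL : List ℕ → ℕ
maxL = foldr _⊔_ 0

minL : List ℕ → ℕ
minL []           = 0
minL (x ∷ [])     = x
minL (x ∷ y ∷ xs) = x ⊓ minL (y ∷ xs)

distTo : ℕ → List ℕ → ℕ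
distTo d hs = minL (map (λ h → ∣ d - h ∣) hs)

nabla : {n : ℕ} {G : Graph n} → SetFun n → Spanning G → ℕ
nabla {n} H F = sum (map (λ v → distTo (deg F v) (H v)) (allFin n))

Optimal : {n : ℕ} (G : Graph n) → SetFun n → Spanning G → Set
Optimal G H F = ∀ (F' : Spanning G) → nabla H F ≤ nabla H F'

InI : {n : ℕ} (G : Graph n) → SetFun n → Fin n → ℕ → Set
InI G H v k = Σ (Spanning G) λ F → Optimal G H F × deg F v ≡ k

InC : {n : ℕ} (G : Graph n) → SetFun n → Fin n → Set
InC G H v = ∀ k → InI G H v k → k ∈ H v

InA : {n : ℕ} (G : Graph n) → SetFun n → Fin n → Set
InA G H v = ¬ InC G H v × (∀ k → InI G H v k → maxL (H v) ≤ k)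

InB : {n : ℕ} (G : Graph n) → SetFun n → Fin n → Set
InB G H v = ¬ InC G H v × (∀ k → InI G H v k → k ≤ minL (H v))

InD : {n : ℕ} (G : Graph n) → SetFun n → Fin n → Set
InD G H v = ¬ InA G H v × ¬ InB G H v × ¬ InC G H v

odds : ℕ → List ℕ
odds k = map (λ i → 1 + 2 * i) (upTo k)

Hf : {n : ℕ} → (Fin n → ℕ) → SetFun n
Hf f v = odds ⌊ f v /2⌋ ++ (f v ∷ [])

data Walk {n : ℕ} (G : Graph n) (R : Fin n → Bool) : Fin n → Fin n → Set where
  here : ∀ {u} → R u ≡ true → Walk G R u u
  step : ∀ {u x w} → R u ≡ true → adj G u x ≡ true → Walk G R x w → Walk G R u w

IsComponent : {n : ℕ} (G : Graph n) (S R : Fin n → Bool) → Set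
IsComponent G S R =
    (∀ u → R u ≡ true → S u ≡ true)
  × ∃ (λ u → R u ≡ true)
  × (∀ u w → R u ≡ true → R w ≡ true → Walk G R u w)
  × (∀ u w → R u ≡ true → S w ≡ true → adj G u w ≡ true → R w ≡ true)

-- |E_G(S,T)| for disjoint S, T: ordered pairs (u,w), u ∈ S, w ∈ T, uw ∈ E(G)
edgesBetween : {n : ℕ} (G : Graph n) (S T : Fin n → Bool) → ℕ
edgesBetween {n} G S T =
  sum (map (λ u → if S u then count (λ w → if T w then adj G u w else false) else 0) (allFin n))

{-# OPTIONS --safe #-}
module Submission where

-- Deviations at v are measured by the function cost, and at v the degrees split into those
-- below f v and those at least f v ("low" and "high"). Call v a defect of an optimal F
-- when its deviation is positive.
--
-- The exchange step along alternating trails shows that a vertex which is a defect of some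
-- optimal subgraph is always low or always high: for a closest pair F, F' violating this,
-- move the defect of F towards F'; every move stays optimal, and when it gets stuck at w,
-- F' has a defect at w that can be moved towards F instead, giving a closer pair. Hence the
-- vertices of B and D are low in every optimal subgraph.
--
-- Flipping any edge vx of G at a low defect v makes x the defect instead of v and keeps F
-- optimal. So no neighbour of v lies in C, edges from v to A are absent from F, edges from v
-- to B are present, and, since a defect can walk through a connected set R of low vertices,
-- R has at most one defect. Low degrees are odd exactly off the defects, so counting degrees
-- over R modulo 2 gives the claims. Equations modulo 2 are decidable, which allows a
-- double-negation elimination when an optimal F with a given defect is chosen.

open import Defs hiding (sym)
import Data.Nat.ListAction as List
open import Data.Bool.Base using (Bool; true; false; not; _∧_; _∨_; _xor_; if_then_else_)
open import Data.Bool.Properties using (∨-comm; ∧-comm; ¬-not; ∧-zeroʳ; ∧-identityʳ)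
open import Data.Empty using (⊥; ⊥-elim)
open import Data.Fin.Base using (Fin; zero; suc)
open import Data.Fin.Properties using (_≟_)
open import Data.List.Base using (List; []; _∷_; map; allFin; tabulate; _++_; upTo; applyUpTo)
open import Data.List.Membership.Propositional using (_∈_)
open import Data.List.Membership.Propositional.Properties using (∈-map⁺; ∈-map⁻)
open import Data.List.Properties using (map-tabulate; map-applyUpTo; map-∘; map-cong; map-++)
open import Data.List.Relation.Unary.Any using (here; there)
open import Data.Nat.Base
open import Data.Nat.DivMod using ([m+kn]%n≡m%n)
open import Data.Nat.Divisibility using (_∣_; divides)
open import Data.Nat.Properties renaming (_≟_ to _≟ℕ_)
open import Data.Nat.Solver using (module +-*-Solver)
open import Data.Product.Base using (_×_; _,_; proj₁; proj₂; ∃; ∃₂)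
open import Data.Sum.Base using (_⊎_; inj₁; inj₂; [_,_]′)
open import Data.Vec.Functional using (Vector; updateAt)
open import Data.Vec.Functional.Properties using (updateAt-updates; updateAt-minimal)
open import Function.Base using (_∘_)
open import Function.Bundles using (_⇔_; Equivalence)
open import Relation.Binary.Definitions using (tri<; tri≈; tri>)
open import Relation.Binary.PropositionalEquality
open import Relation.Nullary using (¬_; contradiction; Dec; yes; no; does)
open import Relation.Nullary.Decidable using (dec-true; dec-false; decidable-stable)

open import Algebra.Properties.Semiring.Sum +-*-semiring using (*-distribˡ-sum)
open import Algebra.Properties.CommutativeMonoid.Sum +-0-commutativeMonoid
  using (∑-distrib-+; sum-cong-≗; sum-replicate-zero) renaming (sum to ∑)

-- The deviation of one degree under unit steps

true≢false : ∀ {t : Bool} → t ≡ true → t ≢ false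
true≢false refl ()

-- cost m k is the distance from k to {1, 3, …, 2m − 1, 2m}, and low m k decides k < 2m.
cost : ℕ → ℕ → ℕ
cost zero    k             = k
cost (suc m) zero          = 1
cost (suc m) (suc zero)    = 0
cost (suc m) (suc (suc k)) = cost m k

low : ℕ → ℕ → Bool
low zero    k             = false
low (suc m) zero          = true
low (suc m) (suc zero)    = true
low (suc m) (suc (suc k)) = low m k

cost-zero-≤1 : ∀ m → cost m 0 ≤ 1
cost-zero-≤1 zero    = z≤n
cost-zero-≤1 (suc m) = ≤-refl

cost-suc-≤ : ∀ m k → cost m (suc k) ≤ suc (cost m k)
cost-suc-≤ zero    k             = ≤-refl
cost-suc-≤ (suc m) zero          = z≤n
cost-suc-≤ (suc m) (suc zero)    = cost-zero-≤1 m
cost-suc-≤ (suc m) (suc (suc k)) = cost-suc-≤ m k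

cost-≤-suc : ∀ m k → cost m k ≤ suc (cost m (suc k))
cost-≤-suc zero    k             = m≤n⇒m≤1+n (n≤1+n k)
cost-≤-suc (suc m) zero          = ≤-refl
cost-≤-suc (suc m) (suc zero)    = z≤n
cost-≤-suc (suc m) (suc (suc k)) = cost-≤-suc m k

gain-down : ∀ m k → cost m (suc k) ≢ 0 → suc (cost m k) ≡ cost m (suc k)
gain-down zero          k             p = refl
gain-down (suc m)       zero          p = ⊥-elim (p refl)
gain-down (suc zero)    (suc zero)    p = ⊥-elim (p refl)
gain-down (suc (suc m)) (suc zero)    p = refl
gain-down (suc m)       (suc (suc k)) p = gain-down m k p

-- Low defects are even, so the next number is odd, at most `2 * m - 1`, and has deviation zero; the
-- step cannot leave the low side.
gain-up : ∀ m k → low m k ≡ true → cost m k ≢ 0 →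
          suc (cost m (suc k)) ≡ cost m k × low m (suc k) ≡ true
gain-up (suc m) zero          l p = refl , refl
gain-up (suc m) (suc zero)    l p = ⊥-elim (p refl)
gain-up (suc m) (suc (suc k)) l p = gain-up m k l p

high-down : ∀ m k → low m (suc k) ≡ false → cost m (suc k) ≢ 0 → low m k ≡ false
high-down zero          k             l p = refl
high-down (suc m)       zero          () p
high-down (suc zero)    (suc zero)    l p = ⊥-elim (p refl)
high-down (suc (suc m)) (suc zero)    () p
high-down (suc m)       (suc (suc k)) l p = high-down m k l p

high-up : ∀ m k → low m k ≡ false → cost m (suc k) ≡ suc (cost m k)
high-up zero    k             l = refl
high-up (suc m) (suc (suc k)) l = high-up m k l

loss-up-low : ∀ m k → cost m (suc k) ≡ suc (cost m k) → low m (suc k) ≡ low m k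
loss-up-low zero          k             e = refl
loss-up-low (suc m)       zero          ()
loss-up-low (suc zero)    (suc zero)    ()
loss-up-low (suc (suc m)) (suc zero)    e = refl
loss-up-low (suc m)       (suc (suc k)) e = loss-up-low m k e

loss-down-low : ∀ m k → cost m k ≡ suc (cost m (suc k)) → low m k ≡ true × low m (suc k) ≡ true
loss-down-low zero          k             e = ⊥-elim (m≢1+n+m k {1} e)
loss-down-low (suc m)       zero          e = refl , refl
loss-down-low (suc m)       (suc zero)    ()
loss-down-low (suc m)       (suc (suc k)) e = loss-down-low m k e

low⇒< : ∀ m k → low m k ≡ true → k < 2 * m
low⇒< (suc m) zero          l = s≤s z≤n
low⇒< (suc m) (suc zero)    l rewrite +-suc m (m + 0) = s≤s (s≤s z≤n)
low⇒< (suc m) (suc (suc k)) l rewrite +-suc m (m + 0) = s≤s (s≤s (low⇒< m k l))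

high⇒≥ : ∀ m k → low m k ≡ false → 2 * m ≤ k
high⇒≥ zero    k             l = z≤n
high⇒≥ (suc m) (suc (suc k)) l rewrite +-suc m (m + 0) = s≤s (s≤s (high⇒≥ m k l))

low<high : ∀ m {k l} → low m k ≡ true → low m l ≡ false → k < l
low<high m p q = <-≤-trans (low⇒< m _ p) (high⇒≥ m _ q)

-- Below `2 * m` the members of the set are the odd numbers, so the deviation is exactly the
-- correction that makes the degree odd. All parity claims come from here.
low-parity : ∀ m k → low m k ≡ true → cost m k + k ≡ 1 + 2 * ⌊ k /2⌋
low-parity (suc m) zero          l = refl
low-parity (suc m) (suc zero)    l = refl
low-parity (suc m) (suc (suc k)) l = begin
  cost m k + suc (suc k)       ≡⟨ +-suc _ _ ⟩
  suc (cost m k + suc k)       ≡⟨ cong suc (+-suc _ _) ⟩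
  2 + (cost m k + k)           ≡⟨ cong (2 +_) (low-parity m k l) ⟩
  3 + 2 * ⌊ k /2⌋              ≡⟨ cong suc (sym (*-suc 2 ⌊ k /2⌋)) ⟩
  1 + 2 * suc ⌊ k /2⌋          ∎
  where open ≡-Reasoning

low-cost≤1 : ∀ m k → low m k ≡ true → cost m k ≤ 1
low-cost≤1 (suc m) zero          l = ≤-refl
low-cost≤1 (suc m) (suc zero)    l = z≤n
low-cost≤1 (suc m) (suc (suc k)) l = low-cost≤1 m k l

-- Unit steps towards a target degree

toward : ℕ → ℕ → ℕ
toward zero    zero    = zero
toward zero    (suc l) = 1
toward (suc k) zero    = k
toward (suc k) (suc l) = suc (toward k l)

toward-up : ∀ {k l} → k < l → toward k l ≡ suc k
toward-up {zero}  {suc l} p       = refl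
toward-up {suc k} {suc l} (s≤s p) = cong suc (toward-up p)

toward-down : ∀ {k l} → l ≤ k → toward (suc k) l ≡ k
toward-down {k}     {zero}  p       = refl
toward-down {suc k} {suc l} (s≤s p) = cong suc (toward-down p)

-- Meant for the far end of a flipped edge, whose degree changes by one in an uncontrolled
-- direction: if the change leads away from `l`, undoing it is a step towards `l`, and the trail can
-- go on from there.
step-or-back : ∀ {k k'} l → k' ≡ suc k ⊎ k ≡ suc k' →
  (k ≢ l × k' ≡ toward k l) ⊎ (k' ≢ l × toward k' l ≡ k)
step-or-back {k} l (inj₁ refl) with k <? l
... | yes p = inj₁ ((λ { refl → <-irrefl refl p }) , sym (toward-up p))
... | no ¬p = inj₂ ((λ { refl → ¬p ≤-refl }) , toward-down (≮⇒≥ ¬p))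
step-or-back {_} {k'} l (inj₂ refl) with k' <? l
... | yes p = inj₂ ((λ { refl → <-irrefl refl p }) , toward-up p)
... | no ¬p = inj₁ ((λ { refl → ¬p ≤-refl }) , sym (toward-down (≮⇒≥ ¬p)))

data Toward : (k l k' : ℕ) → Set where
  up   : ∀ {k l} → k < l → Toward k l (suc k)
  down : ∀ {k l} → l ≤ k → Toward (suc k) l k

toward-view : ∀ k l → k ≢ l → Toward k l (toward k l)
toward-view zero    zero    p = ⊥-elim (p refl)
toward-view zero    (suc l) p = up (s≤s z≤n)
toward-view (suc k) zero    p = down z≤n
toward-view (suc k) (suc l) p with toward k l | toward-view k l (λ e → p (cong suc e))
... | _ | up q   = up (s≤s q)
... | _ | down q = down (s≤s q)

toward-dist : ∀ k l → k ≢ l → suc ∣ toward k l - l ∣ ≡ ∣ k - l ∣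
toward-dist zero    zero    p = ⊥-elim (p refl)
toward-dist zero    (suc l) p = refl
toward-dist (suc k) zero    p = cong suc (∣-∣-identityʳ k)
toward-dist (suc k) (suc l) p = toward-dist k l (λ e → p (cong suc e))

cost-toward-≤ : ∀ m k l → k ≢ l → cost m (toward k l) ≤ suc (cost m k)
cost-toward-≤ m k l p with toward k l | toward-view k l p
... | _ | up _   = cost-suc-≤ m _
... | _ | down _ = cost-≤-suc m _

loss-low : ∀ m k l → k ≢ l → cost m (toward k l) ≡ suc (cost m k) → low m (toward k l) ≡ low m k
loss-low m k l p e with toward k l | toward-view k l p
... | _ | up _   = loss-up-low m _ e
... | _ | down _ with loss-down-low m _ e
...   | q , r = trans q (sym r)

-- The target lies above a low defect and below a high one, and those are the directions in which
-- they gain. The members `2 * m - 1` and `2 * m` must be met before the side can change.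
gain-across : ∀ m k l → cost m k ≢ 0 → low m k ≢ low m l →
              suc (cost m (toward k l)) ≡ cost m k × low m (toward k l) ≡ low m k
gain-across m k l c s with low m k in p | low m l in q
... | true  | true  = ⊥-elim (s refl)
... | false | false = ⊥-elim (s refl)
... | true  | false rewrite toward-up (low<high m p q) = gain-up m k p c
... | false | true  with low<high m q p
...   | s≤s r = gain-across-down p r c
  where
  gain-across-down : ∀ {k'} → low m (suc k') ≡ false → l ≤ k' → cost m (suc k') ≢ 0 →
    suc (cost m (toward (suc k') l)) ≡ cost m (suc k') × low m (toward (suc k') l) ≡ false
  gain-across-down {k'} p r c rewrite toward-down r = gain-down m k' c , high-down m k' p c

-- The order of the ends stays open, since either of two subgraphs may have the larger degree at a
-- vertex.
Between : ℕ → ℕ → ℕ → Set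
Between a k b = (a ≤ k × k ≤ b) ⊎ (b ≤ k × k ≤ a)

between-refl : ∀ x y → Between x x y
between-refl x y with ≤-total x y
... | inj₁ p = inj₁ (≤-refl , p)
... | inj₂ p = inj₂ (p , ≤-refl)

between-toward : ∀ {a b} k → k ≢ b → Between a k b → Between a (toward k b) b
between-toward {a} {b} k p q with toward k b | toward-view k b p
... | _ | up r   with q
...   | inj₁ (x , y) = inj₁ (m≤n⇒m≤1+n x , r)
...   | inj₂ (x , y) = ⊥-elim (<⇒≱ r x)
between-toward {a} {b} _ p q | k | down r with q
...   | inj₁ (x , y) = ⊥-elim (<⇒≱ (s≤s r) y)
...   | inj₂ (x , y) = inj₂ (r , ≤-trans (n≤1+n k) y)

-- When a losing step from j towards b has created a defect, either the next step towards b
-- repairs it, or b is itself a defect that is repaired by a step towards a.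
continue-or-return : ∀ m {a b} j → j ≢ b → Between a j b → cost m (toward j b) ≡ suc (cost m j) →
  (toward j b ≢ b × suc (cost m (toward (toward j b) b)) ≡ cost m (toward j b))
  ⊎ (b ≢ a × suc (cost m (toward b a)) ≡ cost m b)
continue-or-return m {a} {b} j p q e with toward j b | toward-view j b p
... | _ | up j<b with q
...   | inj₂ (x , y) = ⊥-elim (<⇒≱ j<b x)
...   | inj₁ (a≤j , y) with <-cmp (suc j) b
...     | tri> _ _ z = ⊥-elim (<⇒≱ z j<b)
...     | tri≈ _ refl _ rewrite toward-down a≤j =
          inj₂ ((λ { refl → <⇒≱ j<b a≤j }) , gain-down m j (λ z → 0≢1+n (trans (sym z) e)))
...     | tri< z z≢ _ with low m (suc j) in l
...       | true rewrite toward-up z = inj₁ (z≢ , proj₁ (gain-up m (suc j) l (λ z → 0≢1+n (trans (sym z) e))))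
-- From the high value `suc j` on, the deviation grows all the way up to `b`; hence `b` is a defect
-- above `a`, and stepping down gains.
...       | false with b | z
...         | suc b' | s≤s j<b' rewrite toward-down (≤-trans a≤j (<⇒≤ j<b')) =
              inj₂ ((λ { refl → <⇒≱ j<b' (≤-trans (n≤1+n b') a≤j) }) , gain-down m b' (high-cost b' j<b'))
  where
  high-cost : ∀ k → j < k → cost m (suc k) ≢ 0
  high-cost k j<k z with low m k in r
  ... | false = 0≢1+n (trans (sym z) (high-up m k r))
  ... | true  = <⇒≱ (low<high m r l) j<k
continue-or-return m {a} {b} _ p q e | k | down b≤k with q
... | inj₁ (x , y) = ⊥-elim (<⇒≱ (s≤s b≤k) y)
... | inj₂ (x , k<a) with <-cmp k b
...   | tri< z _ _ = ⊥-elim (<⇒≱ z b≤k)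
...   | tri≈ _ refl _ rewrite toward-up k<a =
        inj₂ ((λ { refl → <-irrefl refl k<a }) ,
              proj₁ (gain-up m k (proj₁ (loss-down-low m k e)) (λ z → 0≢1+n (trans (sym z) e))))
continue-or-return m {a} {b} _ p q e | suc k | down b≤k | inj₂ (x , k<a) | tri> _ z≢ (s≤s z) rewrite toward-down z =
        inj₁ (z≢ , gain-down m k (λ z → 0≢1+n (trans (sym z) e)))

-- Finite sums and counts

sum-map-allFin : ∀ {n} (x : Vector ℕ n) → List.sum (map x (allFin n)) ≡ ∑ x
sum-map-allFin {n} x = trans (cong List.sum (map-tabulate (λ i → i) x)) (sum-tabulate x)
  where
  sum-tabulate : ∀ {n} (x : Vector ℕ n) → List.sum (tabulate x) ≡ ∑ x
  sum-tabulate {zero}  x = refl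
  sum-tabulate {suc n} x = cong (x zero +_) (sum-tabulate (x ∘ suc))

AgreeOff : ∀ {a} {A : Set a} {n} → Fin n → Vector A n → Vector A n → Set a
AgreeOff v x y = ∀ u → u ≢ v → x u ≡ y u

by-cases : ∀ {p n} {P : Fin n → Set p} v u → P v → (u ≢ v → P u) → P u
by-cases v u p q with u ≟ v
... | yes refl = p
... | no u≢v   = q u≢v

-- The values at `v` are exchanged across the equation, which avoids subtraction of naturals.
∑-agreeOff : ∀ {n} v {x y : Vector ℕ n} → AgreeOff v x y → ∑ x + y v ≡ ∑ y + x v
∑-agreeOff zero {x} {y} e = begin
  x zero + ∑ (x ∘ suc) + y zero    ≡⟨ cong (λ s → x zero + s + y zero) (sum-cong-≗ (λ u → e (suc u) λ ())) ⟩
  x zero + ∑ (y ∘ suc) + y zero    ≡⟨ +-comm (x zero + ∑ (y ∘ suc)) (y zero) ⟩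
  y zero + (x zero + ∑ (y ∘ suc))  ≡⟨ cong (y zero +_) (+-comm (x zero) _) ⟩
  y zero + (∑ (y ∘ suc) + x zero)  ≡⟨ sym (+-assoc (y zero) _ _) ⟩
  y zero + ∑ (y ∘ suc) + x zero    ∎
  where open ≡-Reasoning
∑-agreeOff (suc v) {x} {y} e = begin
  x zero + ∑ (x ∘ suc) + y (suc v)    ≡⟨ +-assoc (x zero) _ _ ⟩
  x zero + (∑ (x ∘ suc) + y (suc v))  ≡⟨ cong₂ _+_ (e zero λ ()) (∑-agreeOff v (λ u p → e (suc u) λ { refl → p refl })) ⟩
  y zero + (∑ (y ∘ suc) + x (suc v))  ≡⟨ sym (+-assoc (y zero) _ _) ⟩
  y zero + ∑ (y ∘ suc) + x (suc v)    ∎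
  where open ≡-Reasoning

∑-agreeOff-suc : ∀ {n} v {x y : Vector ℕ n} → AgreeOff v x y → suc (y v) ≡ x v → ∑ x ≡ suc (∑ y)
∑-agreeOff-suc v {x} {y} e p = +-cancelʳ-≡ (y v) _ _ (begin
  ∑ x + y v          ≡⟨ ∑-agreeOff v e ⟩
  ∑ y + x v          ≡⟨ cong (∑ y +_) (sym p) ⟩
  ∑ y + suc (y v)    ≡⟨ +-suc (∑ y) (y v) ⟩
  suc (∑ y) + y v    ∎)
  where open ≡-Reasoning

∑-mono-≤ : ∀ {n} {x y : Vector ℕ n} → (∀ u → x u ≤ y u) → ∑ x ≤ ∑ y
∑-mono-≤ {zero}  p = z≤n
∑-mono-≤ {suc n} p = +-mono-≤ (p zero) (∑-mono-≤ (p ∘ suc))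

∑-mono-< : ∀ {n} {x y : Vector ℕ n} → (∀ u → x u ≤ y u) → ∀ v → x v < y v → ∑ x < ∑ y
∑-mono-< p zero    q = +-mono-<-≤ q (∑-mono-≤ (p ∘ suc))
∑-mono-< p (suc v) q = +-mono-≤-< (p zero) (∑-mono-< (p ∘ suc) v q)

∑-<⇒∃< : ∀ {n} (x y : Vector ℕ n) → ∑ x < ∑ y → ∃ λ j → x j < y j
∑-<⇒∃< {suc n} x y p with y zero ≤? x zero
... | no ¬q = zero , ≰⇒> ¬q
... | yes q with ∑-<⇒∃< (x ∘ suc) (y ∘ suc) (≰⇒> λ r → <⇒≱ p (+-mono-≤ q r))
...   | j , r = suc j , r

∑-zero : ∀ {n} {x : Vector ℕ n} → (∀ u → x u ≡ 0) → ∑ x ≡ 0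
∑-zero {n} p = trans (sum-cong-≗ p) (sum-replicate-zero n)

∑-single : ∀ {n} v {x : Vector ℕ n} → (∀ u → u ≢ v → x u ≡ 0) → ∑ x ≡ x v
∑-single {n} v {x} p = begin
  ∑ x              ≡⟨ sym (+-identityʳ _) ⟩
  ∑ x + 0          ≡⟨ ∑-agreeOff v {y = λ _ → 0} p ⟩
  ∑ {n} (λ _ → 0) + x v  ≡⟨ cong (_+ x v) (∑-zero {n} (λ _ → refl)) ⟩
  x v              ∎
  where open ≡-Reasoning

-- The handshake argument: the first row and the first column have equal sums, and induction handles
-- the remaining square.
∑∑-even : ∀ {n} (M : Fin n → Fin n → ℕ) → (∀ u w → M u w ≡ M w u) → (∀ u → M u u ≡ 0) →
          ∃ λ k → ∑ (λ u → ∑ (M u)) ≡ k * 2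
∑∑-even {zero}  M M-sym M-diag = 0 , refl
∑∑-even {suc n} M M-sym M-diag with ∑∑-even (λ u w → M (suc u) (suc w)) (λ u w → M-sym _ _) (M-diag ∘ suc)
... | k , e = row + k , (begin
  M zero zero + row + ∑ (λ u → M (suc u) zero + ∑ (λ w → M (suc u) (suc w)))
    ≡⟨ cong₂ _+_ (cong (_+ row) (M-diag zero)) (∑-distrib-+ (λ u → M (suc u) zero) _) ⟩
  row + (∑ (λ u → M (suc u) zero) + ∑ (λ u → ∑ (λ w → M (suc u) (suc w))))
    ≡⟨ cong₂ (λ s t → row + (s + t)) (sum-cong-≗ (λ u → M-sym (suc u) zero)) e ⟩
  row + (row + k * 2)
    ≡⟨ solve 2 (λ r k → r :+ (r :+ k :* con 2) := (r :+ k) :* con 2) refl row k ⟩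
  (row + k) * 2  ∎)
  where
  open ≡-Reasoning
  open +-*-Solver
  row = ∑ (λ w → M zero (suc w))

count-∑ : ∀ {n} (P : Fin n → Bool) → count P ≡ ∑ (indicator ∘ P)
count-∑ P = sum-map-allFin (indicator ∘ P)

count-insert : ∀ {n} v {P Q : Fin n → Bool} → AgreeOff v P Q → P v ≡ false → Q v ≡ true →
               count Q ≡ suc (count P)
count-insert v {P} {Q} e p q
  with ∑-agreeOff v {indicator ∘ P} {indicator ∘ Q} (λ u r → cong indicator (e u r))
... | h rewrite p | q | count-∑ P | count-∑ Q | +-identityʳ (∑ (indicator ∘ Q)) =
  trans (sym h) (+-comm _ 1)

count-<⇒∃ : ∀ {n} (P Q : Fin n → Bool) → count P < count Q → ∃ λ j → P j ≡ false × Q j ≡ true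
count-<⇒∃ P Q p with ∑-<⇒∃< (indicator ∘ P) (indicator ∘ Q) (subst₂ _<_ (count-∑ P) (count-∑ Q) p)
... | j , q with P j in e | Q j in f
...   | false | true  = j , e , f
...   | true  | false = ⊥-elim (n≮0 q)
...   | true  | true  = ⊥-elim (<-irrefl refl q)
...   | false | false = ⊥-elim (<-irrefl refl q)

-- Moving one coordinate of a degree vector

bump : ∀ {n} → Vector ℕ n → Vector ℕ n → Fin n → Vector ℕ n
bump a b v = updateAt a v (λ k → toward k (b v))

bump-at : ∀ {n} (a b : Vector ℕ n) v → bump a b v v ≡ toward (a v) (b v)
bump-at a b v = updateAt-updates v a

bump-off : ∀ {n} (a b : Vector ℕ n) v → AgreeOff v a (bump a b v)
bump-off a b v u p = sym (updateAt-minimal u v a p)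

bump-unique : ∀ {n} {a c : Vector ℕ n} b v → AgreeOff v a c → c v ≡ toward (a v) (b v) → c ≗ bump a b v
bump-unique {a = a} {c} b v e p u = by-cases {P = λ u → c u ≡ bump a b v u} v u (trans p (sym (bump-at a b v)))
  λ u≢v → trans (sym (e u u≢v)) (bump-off a b v u u≢v)

-- Edge flips and exchange along alternating trails

module _ {n} {G : Graph n} where

  private
    joins : Fin n → Fin n → Fin n → Fin n → Bool
    joins u v x y = (does (x ≟ u) ∧ does (y ≟ v)) ∨ (does (x ≟ v) ∧ does (y ≟ u))

    joins-sym : ∀ u v x y → joins u v x y ≡ joins u v y x
    joins-sym u v x y = trans (∨-comm (does (x ≟ u) ∧ does (y ≟ v)) _)
      (cong₂ _∨_ (∧-comm (does (x ≟ v)) _) (∧-comm (does (x ≟ u)) _))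

    joins-resp : ∀ (h : Fin n → Fin n → Bool) → (∀ x y → h x y ≡ h y x) →
                 ∀ u v x y → joins u v x y ≡ true → h x y ≡ h u v
    joins-resp h h-sym u v x y q with x ≟ u | y ≟ v | x ≟ v | y ≟ u
    ... | yes refl | yes refl | _        | _        = refl
    ... | yes _    | no _     | yes refl | yes refl = h-sym v u
    ... | no _     | _        | yes refl | yes refl = h-sym v u
    joins-resp h h-sym u v x y () | yes _ | no _ | no _  | _
    joins-resp h h-sym u v x y () | yes _ | no _ | yes _ | no _
    joins-resp h h-sym u v x y () | no _  | _    | no _  | _
    joins-resp h h-sym u v x y () | no _  | _    | yes _ | no _

    joins-off : ∀ u v x y → x ≢ u → x ≢ v → joins u v x y ≡ false
    joins-off u v x y p q rewrite dec-false (x ≟ u) p | dec-false (x ≟ v) q = refl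

    joins-left : ∀ u v y → u ≢ v → joins u v u y ≡ does (y ≟ v)
    joins-left u v y p rewrite dec-true (u ≟ u) refl | dec-false (u ≟ v) p with does (y ≟ v)
    ... | true  = refl
    ... | false = refl

    joins-swap : ∀ u v x y → joins u v x y ≡ joins v u x y
    joins-swap u v x y = ∨-comm (does (x ≟ u) ∧ does (y ≟ v)) _

  adj-≢ : ∀ {u v} → adj G u v ≡ true → u ≢ v
  adj-≢ {u} p refl = true≢false p (irrefl G u)

  -- The symmetric difference with a single edge, so that insertion and deletion are one operation.
  flip : (F : Spanning G) (u v : Fin n) → adj G u v ≡ true → Spanning G
  flip F u v p .sub x y = joins u v x y xor sub F x y
  flip F u v p .subSym x y = cong₂ _xor_ (joins-sym u v x y) (subSym F x y)
  flip F u v p .subAdj x y q with joins u v x y in e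
  ... | true  = trans (joins-resp (adj G) (Graph.sym G) u v x y e) p
  ... | false = subAdj F x y q

  flip-swap : ∀ F u v p q x y → sub (flip F u v p) x y ≡ sub (flip F v u q) x y
  flip-swap F u v p q x y = cong (_xor sub F x y) (joins-swap u v x y)

  flip-off : ∀ F u v p {x} y → x ≢ u → x ≢ v → sub (flip F u v p) x y ≡ sub F x y
  flip-off F u v p {x} y q r rewrite joins-off u v x y q r = refl

  flip-row : ∀ F u v p y → y ≢ v → sub (flip F u v p) u y ≡ sub F u y
  flip-row F u v p y q rewrite joins-left u v y (adj-≢ p) | dec-false (y ≟ v) q = refl

  flip-edge : ∀ F u v p → sub (flip F u v p) u v ≡ not (sub F u v)
  flip-edge F u v p rewrite joins-left u v v (adj-≢ p) | dec-true (v ≟ v) refl = refl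

  deg-cong : ∀ (F F' : Spanning G) x → (∀ y → sub F x y ≡ sub F' x y) → deg F x ≡ deg F' x
  deg-cong F F' x e = trans (count-∑ (sub F x))
    (trans (sum-cong-≗ (λ y → cong indicator (e y))) (sym (count-∑ (sub F' x))))

  deg-flip-off : ∀ F u v p {x} → x ≢ u → x ≢ v → deg (flip F u v p) x ≡ deg F x
  deg-flip-off F u v p {x} q r = deg-cong (flip F u v p) F x (λ y → flip-off F u v p y q r)

  deg-flip-add : ∀ F u v p → sub F u v ≡ false → deg (flip F u v p) u ≡ suc (deg F u)
  deg-flip-add F u v p e =
    count-insert v (λ y q → sym (flip-row F u v p y q)) e (trans (flip-edge F u v p) (cong not e))

  deg-flip-remove : ∀ F u v p → sub F u v ≡ true → deg F u ≡ suc (deg (flip F u v p) u)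
  deg-flip-remove F u v p e =
    count-insert v (flip-row F u v p) (trans (flip-edge F u v p) (cong not e)) e

  deg-flip-swap : ∀ F u v p q x → deg (flip F u v p) x ≡ deg (flip F v u q) x
  deg-flip-swap F u v p q x = deg-cong (flip F u v p) (flip F v u q) x (flip-swap F u v p q x)

  deg-flip-step : ∀ F u v p → deg (flip F u v p) u ≡ suc (deg F u) ⊎ deg F u ≡ suc (deg (flip F u v p) u)
  deg-flip-step F u v p with sub F u v in e
  ... | false = inj₁ (deg-flip-add F u v p e)
  ... | true  = inj₂ (deg-flip-remove F u v p e)

  deg-flip-step′ : ∀ F u v p → deg (flip F u v p) v ≡ suc (deg F v) ⊎ deg F v ≡ suc (deg (flip F u v p) v)
  deg-flip-step′ F u v p rewrite deg-flip-swap F u v p (trans (Graph.sym G v u) p) v =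
    deg-flip-step F v u (trans (Graph.sym G v u) p)

  private
    -- Twice the size of the symmetric difference; it bounds the length of an alternating trail.
    diff : Spanning G → Spanning G → ℕ
    diff F F' = ∑ λ x → ∑ λ y → indicator (sub F x y xor sub F' x y)

    diff-flip-< : ∀ F F' u v p → sub F u v ≢ sub F' u v → diff (flip F u v p) F' < diff F F'
    diff-flip-< F F' u v p ne =
      ∑-mono-< (λ x → ∑-mono-≤ (pointwise x)) u (∑-mono-< (pointwise u) v strict)
      where
      xor-≢ : ∀ {s t} → s ≢ t → suc (indicator (not s xor t)) ≡ indicator (s xor t)
      xor-≢ {true}  {true}  q = ⊥-elim (q refl)
      xor-≢ {true}  {false} q = refl
      xor-≢ {false} {true}  q = refl
      xor-≢ {false} {false} q = ⊥-elim (q refl)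

      strict : indicator (sub (flip F u v p) u v xor sub F' u v) < indicator (sub F u v xor sub F' u v)
      strict rewrite flip-edge F u v p = ≤-reflexive (xor-≢ ne)

      pointwise : ∀ x y → indicator (sub (flip F u v p) x y xor sub F' x y) ≤ indicator (sub F x y xor sub F' x y)
      pointwise x y with joins u v x y in e
      ... | false = ≤-refl
      ... | true  = ≤-trans (n≤1+n _) (≤-reflexive (xor-≢ λ q → ne (begin
        sub F u v   ≡⟨ sym (joins-resp (sub F) (subSym F) u v x y e) ⟩
        sub F x y   ≡⟨ q ⟩
        sub F' x y  ≡⟨ joins-resp (sub F') (subSym F') u v x y e ⟩
        sub F' u v  ∎)))
        where open ≡-Reasoning

    first-edge : ∀ (F F' : Spanning G) v → deg F v ≢ deg F' v →
      ∃₂ λ x p → sub F v x ≢ sub F' v x × deg (flip F v x p) v ≡ toward (deg F v) (deg F' v)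
    first-edge F F' v ne with <-cmp (deg F v) (deg F' v)
    ... | tri≈ _ e _ = ⊥-elim (ne e)
    ... | tri< l _ _ with count-<⇒∃ (sub F v) (sub F' v) l
    ...   | x , e , e' = x , subAdj F' v x e' , (λ q → true≢false e' (trans (sym q) e))
                       , trans (deg-flip-add F v x (subAdj F' v x e') e) (sym (toward-up l))
    first-edge F F' v ne | tri> _ _ l with count-<⇒∃ (sub F' v) (sub F v) l
    ...   | x , e' , e = x , subAdj F v x e , (λ q → true≢false e (trans q e'))
                       , down-step (deg-flip-remove F v x (subAdj F v x e) e) l
      where
      down-step : ∀ {k k' l} → k ≡ suc k' → l < k → k' ≡ toward k l
      down-step refl (s≤s q) = sym (toward-down q)

  -- Follow an alternating trail in the symmetric difference. Flipping `vx` moves `v` towards `F'`.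
  -- If `x` moves towards `F'` as well, the trail ends there; otherwise the next edge at `x` has to
  -- undo that change, and `diff` has dropped. Inner visits cancel, so only the two ends of the
  -- trail move. They may coincide, hence the second `bump` starts from `mid`.
  exchange : ∀ N (F F' : Spanning G) → diff F F' < N → ∀ v → deg F v ≢ deg F' v →
    let mid = bump (deg F) (deg F') v in
    ∃₂ λ (F₂ : Spanning G) w → mid w ≢ deg F' w × deg F₂ ≗ bump mid (deg F') w
  exchange (suc N) F F' (s≤s d) v ne with first-edge F F' v ne
  ... | x , p , e , q with step-or-back (deg F' x) (deg-flip-step′ F v x p)
  ...   | inj₁ (x≢ , r) = F₁ , x , (λ z → x≢ (trans mid-x z))
        , bump-unique (deg F') x agree (trans r (cong (λ k → toward k (deg F' x)) mid-x))
    where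
    F₁ = flip F v x p
    mid = bump (deg F) (deg F') v
    mid-x : deg F x ≡ mid x
    mid-x = bump-off (deg F) (deg F') v x (adj-≢ p ∘ sym)
    agree : AgreeOff x mid (deg F₁)
    agree u u≢x = by-cases {P = λ u → mid u ≡ deg F₁ u} v u (trans (bump-at (deg F) (deg F') v) (sym q))
      λ u≢v → trans (sym (bump-off (deg F) (deg F') v u u≢v)) (sym (deg-flip-off F v x p u≢v u≢x))
  ...   | inj₂ (x≢ , r) with exchange N (flip F v x p) F' (<-≤-trans (diff-flip-< F F' v x p e) d) x x≢
  ...     | F₂ , w , s , t = F₂ , w , (λ z → s (trans (mids w) z))
          , bump-unique (deg F') w
              (λ u u≢w → trans (sym (mids u)) (trans (bump-off mid₁ (deg F') w u u≢w) (sym (t u))))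
              (trans (t w) (trans (bump-at mid₁ (deg F') w) (cong (λ k → toward k (deg F' w)) (mids w))))
    where
    F₁ = flip F v x p
    mid₁ = bump (deg F₁) (deg F') x
    agree : AgreeOff v (deg F) mid₁
    agree u u≢v = by-cases {P = λ u → deg F u ≡ mid₁ u} x u (sym (trans (bump-at (deg F₁) (deg F') x) r))
      λ u≢x → trans (sym (deg-flip-off F v x p u≢v u≢x)) (bump-off (deg F₁) (deg F') x u u≢x)
    -- The next step at `x` undoes the effect of the flip there, so the recursive call starts from
    -- the same intermediate vector.
    mids : mid₁ ≗ bump (deg F) (deg F') v
    mids = bump-unique (deg F') v agree (trans (sym (bump-off (deg F₁) (deg F') x v (adj-≢ p))) q)

-- Distance between degree vectors

distance : ∀ {n} → Vector ℕ n → Vector ℕ n → ℕ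
distance a b = ∑ λ u → ∣ a u - b u ∣

distance-bump : ∀ {n} (a b : Vector ℕ n) v → a v ≢ b v → distance a b ≡ suc (distance (bump a b v) b)
distance-bump a b v p = ∑-agreeOff-suc v (λ u q → cong (λ k → ∣ k - b u ∣) (bump-off a b v u q))
  (trans (cong (λ k → suc ∣ k - b v ∣) (bump-at a b v)) (toward-dist (a v) (b v) p))

distance-bump² : ∀ {n} {z : Vector ℕ n} x y u w → x u ≢ y u → bump x y u w ≢ y w →
  z ≗ bump (bump x y u) y w → distance z y < distance x y
distance-bump² {z = z} x y u w p q e = begin-strict
  distance z y                          ≡⟨ sum-cong-≗ (λ i → cong (λ k → ∣ k - y i ∣) (e i)) ⟩
  distance (bump (bump x y u) y w) y    <⟨ ≤-reflexive (sym (distance-bump (bump x y u) y w q)) ⟩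
  distance (bump x y u) y               <⟨ ≤-reflexive (sym (distance-bump x y u p)) ⟩
  distance x y                          ∎
  where open ≤-Reasoning

between-bump : ∀ {n} (a b : Vector ℕ n) {c} v → c v ≢ b v →
  (∀ u → Between (a u) (c u) (b u)) → ∀ u → Between (a u) (bump c b v u) (b u)
between-bump a b {c} v p q u = by-cases {P = λ u → Between (a u) (bump c b v u) (b u)} v u
  (subst (λ k → Between (a v) k (b v)) (sym (bump-at c b v)) (between-toward (c v) p (q v)))
  (λ r → subst (λ k → Between (a u) k (b u)) (bump-off c b v u r) (q u))

-- Total deviation after a gain and a loss

module _ {n} (m : Vector ℕ n) where

  total : Vector ℕ n → ℕ
  total x = ∑ λ u → cost (m u) (x u)

  -- The first change lowers the total by one and the second raises it by at most one. As `c` is no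
  -- better than `a`, the second must raise it by exactly one.
  two-step : ∀ {v w} {a mid c : Vector ℕ n} → AgreeOff v a mid → AgreeOff w mid c →
    suc (cost (m v) (mid v)) ≡ cost (m v) (a v) →
    cost (m w) (c w) ≤ suc (cost (m w) (mid w)) → total a ≤ total c →
    total c ≡ total a × cost (m w) (c w) ≡ suc (cost (m w) (mid w))
  two-step {v} {w} {a} {mid} {c} e e' gain loss opt = total≡ ,
    +-cancelˡ-≡ (total mid) _ _ (begin-equality
      total mid + cost (m w) (c w)          ≡⟨ second ⟩
      total c + cost (m w) (mid w)          ≡⟨ cong (_+ cost (m w) (mid w)) (trans total≡ first) ⟩
      suc (total mid) + cost (m w) (mid w)  ≡⟨ sym (+-suc (total mid) _) ⟩
      total mid + suc (cost (m w) (mid w))  ∎)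
    where
    open ≤-Reasoning
    first : total a ≡ suc (total mid)
    first = ∑-agreeOff-suc v (λ u p → cong (cost (m u)) (e u p)) gain
    second : total mid + cost (m w) (c w) ≡ total c + cost (m w) (mid w)
    second = ∑-agreeOff w (λ u p → cong (cost (m u)) (e' u p))
    total≡ : total c ≡ total a
    total≡ = ≤-antisym (+-cancelʳ-≤ (cost (m w) (mid w)) _ _ (begin
      total c + cost (m w) (mid w)          ≡⟨ sym second ⟩
      total mid + cost (m w) (c w)          ≤⟨ +-monoʳ-≤ (total mid) loss ⟩
      total mid + suc (cost (m w) (mid w))  ≡⟨ +-suc (total mid) _ ⟩
      suc (total mid) + cost (m w) (mid w)  ≡⟨ cong (_+ cost (m w) (mid w)) (sym first) ⟩
      total a + cost (m w) (mid w)          ∎)) opt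

-- A defect vertex never changes side

module _ {n} {G : Graph n} (m : Vector ℕ n) where

  Opt : Spanning G → Set
  Opt F = ∀ (F' : Spanning G) → total m (deg F) ≤ total m (deg F')

  Opt-≡ : ∀ {F F'} → Opt F → total m (deg F') ≡ total m (deg F) → Opt F'
  Opt-≡ o e F'' = ≤-trans (≤-reflexive e) (o F'')

  Advance : Spanning G → Spanning G → Fin n → Set
  Advance F F' v = ∃₂ λ (F₂ : Spanning G) w → Opt F₂ × mid w ≢ deg F' w × deg F₂ ≗ bump mid (deg F') w
    × cost (m w) (deg F₂ w) ≡ suc (cost (m w) (mid w))
    where
    mid : Vector ℕ n
    mid = bump (deg F) (deg F') v

  -- The gain at `v` pays for the second unit step supplied by `exchange`; by `two-step` that step
  -- loses exactly one and optimality survives.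
  advance : ∀ (F F' : Spanning G) → Opt F → ∀ v → deg F v ≢ deg F' v →
    suc (cost (m v) (toward (deg F v) (deg F' v))) ≡ cost (m v) (deg F v) → Advance F F' v
  advance F F' o v p gain with exchange _ F F' ≤-refl v p
  ... | F₂ , w , q , r = F₂ , w , Opt-≡ {F} {F₂} o (proj₁ steps) , q , r , proj₂ steps
    where
    a = deg F
    b = deg F'
    mid = bump a b v
    F₂-w : deg F₂ w ≡ toward (mid w) (b w)
    F₂-w = trans (r w) (bump-at mid b w)
    steps = two-step m (bump-off a b v) (λ u s → trans (bump-off mid b w u s) (sym (r u)))
      (trans (cong (suc ∘ cost (m v)) (bump-at a b v)) gain)
      (subst (λ k → cost (m w) k ≤ suc (cost (m w) (mid w))) (sym F₂-w) (cost-toward-≤ (m w) (mid w) (b w) q))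
      (o F₂)

  Crosses : Fin n → Spanning G → Spanning G → Set
  Crosses v F F' = Opt F × Opt F' × cost (m v) (deg F v) ≢ 0 × low (m v) (deg F v) ≢ low (m v) (deg F' v)

  -- f − 1 and f both have cost 0, so a losing step cannot cross between the two sides.
  same-side : ∀ v (F₂ : Spanning G) (x y : Vector ℕ n) w → x w ≢ y w → deg F₂ ≗ bump x y w →
    cost (m w) (deg F₂ w) ≡ suc (cost (m w) (x w)) → low (m v) (deg F₂ v) ≡ low (m v) (x v)
  same-side v F₂ x y w p q e = by-cases {P = λ v → low (m v) (deg F₂ v) ≡ low (m v) (x v)} w v
    (trans (cong (low (m w)) F₂-w)
           (loss-low (m w) (x w) (y w) p (trans (cong (cost (m w)) (sym F₂-w)) e)))
    (λ v≢w → cong (low (m v)) (trans (q v) (sym (bump-off x y w v v≢w))))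
    where
    F₂-w : deg F₂ w ≡ toward (x w) (y w)
    F₂-w = trans (q w) (bump-at x y w)

  module Descent (F F' : Spanning G) (v : Fin n) (crosses : Crosses v F F')
    (smaller : ∀ F₁ F₂ → distance (deg F₁) (deg F₂) < distance (deg F) (deg F') → ¬ Crosses v F₁ F₂) where

    private
      a = deg F
      b = deg F'
      o = proj₁ crosses
      o' = proj₁ (proj₂ crosses)
      c = proj₁ (proj₂ (proj₂ crosses))
      s = proj₂ (proj₂ (proj₂ crosses))

    -- F₁ lies between F and F', and its defect at w was created by a losing step from j; K bounds
    -- the remaining distance to F'.
    chain : ∀ K (F₁ : Spanning G) → distance (deg F₁) b < K → distance (deg F₁) b < distance a b → Opt F₁ →
      (∀ u → Between (a u) (deg F₁ u) (b u)) → low (m v) (deg F₁ v) ≡ low (m v) (a v) →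
      ∀ w j → Between (a w) j (b w) → j ≢ b w → deg F₁ w ≡ toward j (b w) →
      cost (m w) (deg F₁ w) ≡ suc (cost (m w) j) → ⊥
    -- Spends a gain available at `w`: `advance` yields an optimal subgraph strictly closer to `F'`,
    -- with a defect made by a losing step, as `chain` requires. The bounds here are not strict, so
    -- that the process can start from `F` itself.
    push : ∀ K (F₁ : Spanning G) → distance (deg F₁) b ≤ K → distance (deg F₁) b ≤ distance a b → Opt F₁ →
      (∀ u → Between (a u) (deg F₁ u) (b u)) → ∀ w → deg F₁ w ≢ b w →
      suc (cost (m w) (toward (deg F₁ w) (b w))) ≡ cost (m w) (deg F₁ w) →
      low (m v) (bump (deg F₁) b w v) ≡ low (m v) (a v) → ⊥

    push K F₁ k d₁ o₁ btw w ne gain₁ l = next (advance F₁ F' o₁ w ne gain₁)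
      where
      mid : Vector ℕ n
      mid = bump (deg F₁) b w
      btw' : ∀ u → Between (a u) (mid u) (b u)
      btw' = between-bump a b w ne btw
      next : Advance F₁ F' w → ⊥
      next (F₂ , w' , o₂ , ne' , e , loss) =
        chain K F₂ (<-≤-trans closer k) (<-≤-trans closer d₁) o₂
          (λ u → subst (λ z → Between (a u) z (b u)) (sym (e u)) (between-bump a b w' ne' btw' u))
          (trans (same-side v F₂ mid b w' ne' e loss) l)
          w' (mid w') (btw' w') ne' (trans (e w') (bump-at mid b w')) loss
        where
        closer : distance (deg F₂) b < distance (deg F₁) b
        closer = distance-bump² (deg F₁) b w w' ne ne' e

    chain (suc K) F₁ (s≤s k) d₁ o₁ btw l w j bj ne e loss = either (w ≟ v)
      where
      proceed : w ≢ v → (toward j (b w) ≢ b w × suc (cost (m w) (toward (toward j (b w)) (b w))) ≡ cost (m w) (toward j (b w)))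
        ⊎ (b w ≢ a w × suc (cost (m w) (toward (b w) (a w))) ≡ cost (m w) (b w)) → ⊥
      proceed w≢v (inj₁ (p , gain₁)) = push K F₁ k (<⇒≤ d₁) o₁ btw w (λ z → p (trans (sym e) z))
        (subst (λ z → suc (cost (m w) (toward z (b w))) ≡ cost (m w) z) (sym e) gain₁)
        (trans (cong (low (m v)) (sym (bump-off (deg F₁) b w v (w≢v ∘ sym)))) l)
      -- Stuck on this side, so `F'` moves at `w` towards `F` instead. As `w` differs from `v` and
      -- losing steps keep sides, `v` stays on its side, and `F` forms a closer crossing pair with
      -- the new subgraph.
      proceed w≢v (inj₂ (p , gain₁)) = return (advance F' F o' w p gain₁)
        where
        distance-comm : ∀ (x y : Vector ℕ n) → distance x y ≡ distance y x
        distance-comm x y = sum-cong-≗ (λ u → ∣-∣-comm (x u) (y u))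
        return : Advance F' F w → ⊥
        return (F₂ , w' , o₂ , ne' , e' , loss') =
          smaller F F₂ (subst₂ _<_ (distance-comm (deg F₂) a) (distance-comm b a) (distance-bump² b a w w' p ne' e'))
            (o , o₂ , c , (λ z → s (trans z
              (trans (same-side v F₂ (bump b a w) a w' ne' e' loss')
                     (cong (low (m v)) (sym (bump-off b a w v (w≢v ∘ sym))))))))
      either : Dec (w ≡ v) → ⊥
      -- The defect has returned to `v`, on the side that `v` has in `F`, so `F₁` and `F'` form a
      -- closer crossing pair.
      either (yes w≡v) = smaller F₁ F' d₁ (o₁ , o' , (λ z → 0≢1+n (trans (sym z) (at-v loss))) , (λ z → s (trans (sym l) z)))
        where
        at-v : cost (m w) (deg F₁ w) ≡ suc (cost (m w) j) → cost (m v) (deg F₁ v) ≡ suc (cost (m w) j)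
        at-v = subst (λ u → cost (m u) (deg F₁ u) ≡ suc (cost (m w) j)) w≡v
      either (no w≢v) = proceed w≢v (continue-or-return (m w) j ne bj (trans (cong (cost (m w)) (sym e)) loss))

    impossible : ⊥
    impossible = push (distance a b) F ≤-refl ≤-refl o (λ u → between-refl (a u) (b u)) v
      (λ e → s (cong (low (m v)) e)) (proj₁ gain)
      (trans (cong (low (m v)) (bump-at a b v)) (proj₂ gain))
      where
      gain = gain-across (m v) (a v) (b v) c s

  -- Descent on the distance of the degree vectors. Thus one optimal subgraph with a defect at `v`
  -- settles the side of `v` in all of them.
  no-crossing : ∀ v F F' → ¬ Crosses v F F'
  no-crossing v F F' = below _ F F' ≤-refl
    where
    below : ∀ N F F' → distance (deg F) (deg F') < N → ¬ Crosses v F F'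
    below (suc N) F F' (s≤s d) crosses =
      Descent.impossible F F' v crosses (λ F₁ F₂ d₁ → below N F₁ F₂ (<-≤-trans d₁ d))

-- Passing a defect along an edge

private
  -- A low defect is even and its neighbouring numbers are odd members of the set. This is why any
  -- edge at the defect may be flipped.
  gain-any : ∀ m {k k'} → k' ≡ suc k ⊎ k ≡ suc k' → low m k ≡ true → cost m k ≢ 0 → suc (cost m k') ≡ cost m k
  gain-any m (inj₁ refl) l c = proj₁ (gain-up m _ l c)
  gain-any m (inj₂ refl) l c = gain-down m _ c

  cost-step-≤ : ∀ m {k k'} → k' ≡ suc k ⊎ k ≡ suc k' → cost m k' ≤ suc (cost m k)
  cost-step-≤ m (inj₁ refl) = cost-suc-≤ m _
  cost-step-≤ m (inj₂ refl) = cost-≤-suc m _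

module _ {n} {G : Graph n} (m : Vector ℕ n) where

  Defect : Spanning G → Fin n → Set
  Defect F v = cost (m v) (deg F v) ≢ 0

  Low : Fin n → Set
  Low v = ∀ (F : Spanning G) → Opt m F → low (m v) (deg F v) ≡ true

  -- The flip gains one at `v` by `gain-any` and changes the degree of `x` by one; `two-step` forces
  -- a loss at `x`.
  pass-defect : ∀ (F : Spanning G) v x (p : adj G v x ≡ true) → Opt m F → Defect F v → low (m v) (deg F v) ≡ true →
    Opt m (flip F v x p) × cost (m x) (deg (flip F v x p) x) ≡ suc (cost (m x) (deg F x))
  pass-defect F v x p o c l = Opt-≡ m {F} {F₁} o (proj₁ steps) , trans (proj₂ steps) (cong (suc ∘ cost (m x)) (sym mid-x))
    where
    F₁ : Spanning G
    F₁ = flip F v x p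
    mid : Vector ℕ n
    mid = updateAt (deg F) v (λ _ → deg F₁ v)
    mid-v : mid v ≡ deg F₁ v
    mid-v = updateAt-updates v (deg F)
    mid-off : AgreeOff v (deg F) mid
    mid-off u q = sym (updateAt-minimal u v (deg F) q)
    mid-x : deg F x ≡ mid x
    mid-x = mid-off x (adj-≢ {G = G} p ∘ sym)
    steps : total m (deg F₁) ≡ total m (deg F) × cost (m x) (deg F₁ x) ≡ suc (cost (m x) (mid x))
    steps = two-step m mid-off
      (λ u u≢x → by-cases {P = λ u → mid u ≡ deg F₁ u} v u mid-v
        (λ u≢v → trans (sym (mid-off u u≢v)) (sym (deg-flip-off F v x p u≢v u≢x))))
      (trans (cong (suc ∘ cost (m v)) mid-v) (gain-any (m v) (deg-flip-step F v x p) l c))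
      (≤-trans (cost-step-≤ (m x) (deg-flip-step′ F v x p)) (≤-reflexive (cong (suc ∘ cost (m x)) mid-x)))
      (o F₁)

  -- Connected regions of low vertices

  module _ (R : Fin n → Bool) (R-low : ∀ u → R u ≡ true → Low u) where

    private
      walk-source : ∀ {u w} → Walk G R u w → R u ≡ true
      walk-source (here r)     = r
      walk-source (step r _ _) = r

      ≢-of-R : ∀ {x y} → R x ≡ true → R y ≡ false → y ≢ x
      ≢-of-R p q refl = true≢false p q

    -- Each edge of the walk is flipped in turn. Both its ends are in `R`, so the edges leaving `R`
    -- are untouched.
    move-defect : ∀ {u w} → Walk G R u w → ∀ F → Opt m F → Defect F u →
      ∃ λ (F₁ : Spanning G) → Opt m F₁ × Defect F₁ w × (∀ x y → R y ≡ false → sub F₁ x y ≡ sub F x y)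
    move-defect (here r) F o c = F , o , c , λ _ _ _ → refl
    move-defect (step {u} {x} r p walk) F o c = next (pass-defect F u x p o c (R-low u r F o))
      where
      F₁ : Spanning G
      F₁ = flip F u x p
      same : ∀ y z → R z ≡ false → sub F₁ y z ≡ sub F y z
      same y z q = trans (subSym F₁ y z) (trans
        (flip-off F u x p y (≢-of-R r q) (≢-of-R (walk-source walk) q)) (subSym F z y))
      next : Opt m F₁ × cost (m x) (deg F₁ x) ≡ suc (cost (m x) (deg F x)) → _
      next (o₁ , e) with move-defect walk F₁ o₁ (λ z → 0≢1+n (trans (sym z) e))
      ... | F₂ , o₂ , c₂ , same₂ = F₂ , o₂ , c₂ , λ y z q → trans (same₂ y z q) (same y z q)

    -- Drive the defect from `u` towards `z`. Its first arrival adds one to the deviation at `z`,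
    -- which stays at most one at a low degree; the degree of `z` was unchanged until then.
    defect-unique : ∀ {u z} → Walk G R u z → ∀ F → Opt m F → Defect F u → u ≢ z →
      cost (m z) (deg F z) ≡ 0
    defect-unique (here r) F o c ne = ⊥-elim (ne refl)
    defect-unique {z = z} (step {u} {x} r p walk) F o c ne = next (pass-defect F u x p o c (R-low u r F o))
      where
      F₁ : Spanning G
      F₁ = flip F u x p
      next : Opt m F₁ × cost (m x) (deg F₁ x) ≡ suc (cost (m x) (deg F x)) → cost (m z) (deg F z) ≡ 0
      next (o₁ , e) = either (z ≟ x)
        where
        either : Dec (z ≡ x) → cost (m z) (deg F z) ≡ 0
        either (yes z≡x) = subst (λ z → cost (m z) (deg F z) ≡ 0) (sym z≡x)
          (n≤0⇒n≡0 (≤-pred (≤-trans (≤-reflexive (sym e))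
            (low-cost≤1 (m x) _ (R-low x (walk-source walk) F₁ o₁)))))
        either (no z≢x) = trans (cong (cost (m z)) (sym (deg-flip-off F u x p (ne ∘ sym) z≢x)))
          (defect-unique walk F₁ o₁ (λ q → 0≢1+n (trans (sym q) e)) (z≢x ∘ sym))

    -- Deviation plus degree is odd at each vertex of `R`, the deviations sum to one, and the
    -- degrees sum to twice the inner edges plus the edges to `T`.
    region-parity : ∀ (T : Fin n → Bool) → (∀ w → R w ≡ true → T w ≡ false) →
      (∀ F → Opt m F → ∀ u w → Defect F u → R u ≡ true → R w ≡ false → sub F u w ≡ T w ∧ adj G u w) →
      (∀ u w → R u ≡ true → R w ≡ true → Walk G R u w) →
      ∀ v → R v ≡ true → ∀ F → Opt m F → Defect F v → (count R + edgesBetween G R T) % 2 ≡ 1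
    region-parity T T-off boundary connected v Rv F o c = begin
      (count R + edgesBetween G R T) % 2          ≡⟨ cong₂ (λ s t → (s + t) % 2) (count-∑ R) edges ⟩
      -- `H` adds up the halved degrees; its double is added because `low-parity` produces it.
      (size + crossing) % 2                       ≡⟨ sym ([m+kn]%n≡m%n (size + crossing) H 2) ⟩
      (size + crossing + H * 2) % 2               ≡⟨ cong (_% 2) rearrange ⟩
      (1 + (E + crossing) * 2) % 2                ≡⟨ [m+kn]%n≡m%n 1 (E + crossing) 2 ⟩
      1                                           ∎
      where
      open ≡-Reasoning
      open +-*-Solver
      r : Vector ℕ n
      r u = indicator (R u)
      size crossing H E : ℕ
      size = ∑ r
      leaving : Fin n → Fin n → ℕ
      leaving u w = indicator (T w ∧ adj G u w)
      crossing = ∑ λ u → r u * ∑ (leaving u)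
      H = ∑ λ u → r u * ⌊ deg F u /2⌋

      edges : edgesBetween G R T ≡ crossing
      edges = trans (sum-map-allFin (λ u → if R u then count (λ w → if T w then adj G u w else false) else 0))
        (sum-cong-≗ row)
        where
        if-∧ : ∀ s t → (if s then t else false) ≡ s ∧ t
        if-∧ true  t = refl
        if-∧ false t = refl
        row : ∀ u → (if R u then count (λ w → if T w then adj G u w else false) else 0) ≡ r u * ∑ (leaving u)
        row u with R u
        ... | false = refl
        ... | true  = trans (count-∑ (λ w → if T w then adj G u w else false))
          (trans (sum-cong-≗ (λ w → cong indicator (if-∧ (T w) (adj G u w)))) (sym (+-identityʳ _)))

      inner : Fin n → Fin n → ℕ
      inner u w = r u * (r w * indicator (sub F u w))

      inner-sym : ∀ u w → inner u w ≡ inner w u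
      inner-sym u w = trans (cong (λ t → r u * (r w * indicator t)) (subSym F u w))
        (solve 3 (λ x y z → x :* (y :* z) := y :* (x :* z)) refl (r u) (r w) (indicator (sub F w u)))

      sub-irrefl : ∀ u → sub F u u ≡ false
      sub-irrefl u = ¬-not (λ e → adj-≢ {G = G} (subAdj F u u e) refl)

      inner-diag : ∀ u → inner u u ≡ 0
      inner-diag u rewrite sub-irrefl u | *-zeroʳ (r u) = *-zeroʳ (r u)

      -- `inner` is the adjacency matrix of `F` restricted to `R`, so `E` is the number of edges of
      -- `F` inside `R`.
      even = ∑∑-even inner inner-sym inner-diag
      E = proj₁ even

      -- `boundary` speaks of defects only. Moving the defect from `v` to `u` keeps the edges out of
      -- `R`, so it applies at every `u` in `R`.
      reached : ∀ {u} → R u ≡ true → ∀ w → R w ≡ false → sub F u w ≡ T w ∧ adj G u w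
      reached {u} Ru w Rw with move-defect (connected v u Rv Ru) F o c
      ... | F₁ , o₁ , c₁ , same = trans (sym (same u w Rw)) (boundary F₁ o₁ u w c₁ Ru Rw)

      incident : ∀ u w → r u * indicator (sub F u w) ≡ inner u w + r u * leaving u w
      incident u w with R u in Ru | R w in Rw
      ... | false | _     = refl
      ... | true  | true  rewrite T-off w Rw = sym (trans (+-identityʳ _) (+-identityʳ _))
      ... | true  | false = cong (λ t → indicator t + 0) (reached Ru w Rw)

      degrees : ∑ (λ u → r u * deg F u) ≡ E * 2 + crossing
      degrees = begin
        ∑ (λ u → r u * deg F u)
          ≡⟨ sum-cong-≗ (λ u → cong (r u *_) (count-∑ (sub F u))) ⟩
        ∑ (λ u → r u * ∑ (λ w → indicator (sub F u w)))
          ≡⟨ sum-cong-≗ (λ u → trans (*-distribˡ-sum (r u) (λ w → indicator (sub F u w))) (trans (sum-cong-≗ (incident u))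
               (trans (∑-distrib-+ (inner u) (λ w → r u * leaving u w))
                      (cong (∑ (inner u) +_) (sym (*-distribˡ-sum (r u) (leaving u))))))) ⟩
        ∑ (λ u → ∑ (inner u) + r u * ∑ (leaving u))
          ≡⟨ ∑-distrib-+ (λ u → ∑ (inner u)) (λ u → r u * ∑ (leaving u)) ⟩
        ∑ (λ u → ∑ (inner u)) + crossing
          ≡⟨ cong (_+ crossing) (proj₂ even) ⟩
        E * 2 + crossing ∎

      defects : ∑ (λ u → r u * cost (m u) (deg F u)) ≡ 1
      defects = trans (∑-single v off-v) at-v
        where
        off-v : ∀ u → u ≢ v → r u * cost (m u) (deg F u) ≡ 0
        off-v u u≢v with R u in Ru
        ... | false = refl
        ... | true  = trans (+-identityʳ _) (defect-unique (connected v u Rv Ru) F o c (u≢v ∘ sym))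
        at-v : r v * cost (m v) (deg F v) ≡ 1
        at-v rewrite Rv = trans (+-identityʳ _)
          (≤-antisym (low-cost≤1 (m v) (deg F v) (R-low v Rv F o)) (n≢0⇒n>0 c))

      parities : ∑ (λ u → r u * cost (m u) (deg F u)) + ∑ (λ u → r u * deg F u) ≡ size + (H + H)
      parities = begin
        ∑ (λ u → r u * cost (m u) (deg F u)) + ∑ (λ u → r u * deg F u)
          ≡⟨ sym (∑-distrib-+ (λ u → r u * cost (m u) (deg F u)) (λ u → r u * deg F u)) ⟩
        ∑ (λ u → r u * cost (m u) (deg F u) + r u * deg F u)
          ≡⟨ sum-cong-≗ odd ⟩
        ∑ (λ u → r u + (r u * ⌊ deg F u /2⌋ + r u * ⌊ deg F u /2⌋))
          ≡⟨ ∑-distrib-+ r _ ⟩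
        size + ∑ (λ u → r u * ⌊ deg F u /2⌋ + r u * ⌊ deg F u /2⌋)
          ≡⟨ cong (size +_) (∑-distrib-+ (λ u → r u * ⌊ deg F u /2⌋) (λ u → r u * ⌊ deg F u /2⌋)) ⟩
        size + (H + H) ∎
        where
        odd : ∀ u → r u * cost (m u) (deg F u) + r u * deg F u ≡ r u + (r u * ⌊ deg F u /2⌋ + r u * ⌊ deg F u /2⌋)
        odd u = scale (R u) (cost (m u) (deg F u)) (deg F u) ⌊ deg F u /2⌋
          (λ Ru → low-parity (m u) (deg F u) (R-low u Ru F o))
          where
          scale : ∀ t c d h → (t ≡ true → c + d ≡ 1 + 2 * h) →
            indicator t * c + indicator t * d ≡ indicator t + (indicator t * h + indicator t * h)
          scale false c d h p = refl
          scale true  c d h p = trans (cong₂ _+_ (+-identityʳ c) (+-identityʳ d))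
            (trans (p refl) (cong (λ k → suc (k + (h + 0))) (sym (+-identityʳ h))))

      rearrange : size + crossing + H * 2 ≡ 1 + (E + crossing) * 2
      rearrange = begin
        size + crossing + H * 2
          ≡⟨ solve 3 (λ s x h → s :+ x :+ h :* con 2 := s :+ (h :+ h) :+ x) refl size crossing H ⟩
        size + (H + H) + crossing
          ≡⟨ cong (_+ crossing) (trans (sym parities) (cong₂ _+_ defects degrees)) ⟩
        1 + (E * 2 + crossing) + crossing
          ≡⟨ solve 2 (λ e x → con 1 :+ (e :* con 2 :+ x) :+ x := con 1 :+ (e :+ x) :* con 2) refl E crossing ⟩
        1 + (E + crossing) * 2 ∎

-- The list `Hf f v` and the function `cost`

private
  -- The list `Hf f v` with `f v` equal to `2 * m`, rebuilt by shifts of two to match the recursion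
  -- of `cost`.
  allowed : ℕ → List ℕ
  allowed zero    = 0 ∷ []
  allowed (suc m) = 1 ∷ map (2 +_) (allowed m)

  odds-allowed : ∀ m → odds m ++ (2 * m ∷ []) ≡ allowed m
  odds-allowed zero    = refl
  odds-allowed (suc m) = cong (1 ∷_) (begin
    map (λ i → 1 + 2 * i) (applyUpTo suc m) ++ (2 * suc m ∷ [])
      ≡⟨ cong₂ (λ xs k → map (λ i → 1 + 2 * i) xs ++ (k ∷ [])) (sym (map-applyUpTo (λ i → i) suc m)) (*-suc 2 m) ⟩
    map (λ i → 1 + 2 * i) (map suc (upTo m)) ++ (2 + 2 * m ∷ [])
      ≡⟨ cong (_++ (2 + 2 * m ∷ [])) (sym (map-∘ (upTo m))) ⟩
    map (λ i → 1 + 2 * suc i) (upTo m) ++ (2 + 2 * m ∷ [])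
      ≡⟨ cong (_++ (2 + 2 * m ∷ [])) (map-cong (λ i → cong suc (*-suc 2 i)) (upTo m)) ⟩
    map (λ i → 2 + (1 + 2 * i)) (upTo m) ++ (2 + 2 * m ∷ [])
      ≡⟨ cong (_++ (2 + 2 * m ∷ [])) (map-∘ (upTo m)) ⟩
    map (2 +_) (odds m) ++ (2 + 2 * m ∷ [])
      ≡⟨ sym (map-++ (2 +_) (odds m) (2 * m ∷ [])) ⟩
    map (2 +_) (odds m ++ (2 * m ∷ []))
      ≡⟨ cong (map (2 +_)) (odds-allowed m) ⟩
    map (2 +_) (allowed m) ∎)
    where open ≡-Reasoning

  map-allowed≢[] : ∀ m {f : ℕ → ℕ} → map f (allowed m) ≢ []
  map-allowed≢[] zero    ()
  map-allowed≢[] (suc m) ()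

  minL-∷ : ∀ x {xs} → xs ≢ [] → minL (x ∷ xs) ≡ x ⊓ minL xs
  minL-∷ x {[]}     p = contradiction refl p
  minL-∷ x {y ∷ xs} p = refl

  minL-map-suc : ∀ {xs} → xs ≢ [] → minL (map suc xs) ≡ suc (minL xs)
  minL-map-suc {[]}         p = contradiction refl p
  minL-map-suc {x ∷ []}     p = refl
  minL-map-suc {x ∷ y ∷ xs} p = cong (suc x ⊓_) (minL-map-suc {y ∷ xs} (λ ()))

  maxL-map-2+ : ∀ {xs} → xs ≢ [] → maxL (map (2 +_) xs) ≡ 2 + maxL xs
  maxL-map-2+ {[]}         p = contradiction refl p
  maxL-map-2+ {x ∷ []}     p = cong (2 +_) (sym (⊔-identityʳ x))
  maxL-map-2+ {x ∷ y ∷ xs} p = cong (2 + x ⊔_) (maxL-map-2+ {y ∷ xs} (λ ()))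

  allowed≢[] : ∀ m → allowed m ≢ []
  allowed≢[] zero    ()
  allowed≢[] (suc m) ()

  cost-≤-suc-self : ∀ m k → cost m k ≤ suc k
  cost-≤-suc-self zero    k             = n≤1+n k
  cost-≤-suc-self (suc m) zero          = ≤-refl
  cost-≤-suc-self (suc m) (suc zero)    = z≤n
  cost-≤-suc-self (suc m) (suc (suc k)) = ≤-trans (cost-≤-suc-self m k) (≤-trans (n≤1+n _) (n≤1+n _))

  distTo-allowed : ∀ m k → distTo k (allowed m) ≡ cost m k
  distTo-allowed zero    zero    = refl
  distTo-allowed zero    (suc k) = refl
  distTo-allowed (suc m) k = trans
    (minL-∷ ∣ k - 1 ∣ (λ e → map-allowed≢[] m {λ h → ∣ k - (2 + h) ∣} (trans (map-∘ (allowed m)) e))) (rest k)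
    where
    rest : ∀ k → ∣ k - 1 ∣ ⊓ minL (map (λ h → ∣ k - h ∣) (map (2 +_) (allowed m))) ≡ cost (suc m) k
    rest zero = cong (1 ⊓_) (trans (cong minL (trans (sym (map-∘ (allowed m))) (map-∘ (allowed m))))
      (minL-map-suc (map-allowed≢[] m)))
    rest (suc zero) = refl
    -- Cancelling two turns the tail into `cost m k`, which is at most `suc k`, the distance to the
    -- head.
    rest (suc (suc k)) = trans
      (cong (suc k ⊓_) (trans (cong minL (sym (map-∘ (allowed m)))) (distTo-allowed m k)))
      (m≥n⇒m⊓n≡n (cost-≤-suc-self m k))

  maxL-allowed : ∀ m → maxL (allowed m) ≡ 2 * m
  maxL-allowed zero = refl
  maxL-allowed (suc m) =
    trans (cong (1 ⊔_) (maxL-map-2+ (allowed≢[] m))) (trans (cong (2 +_) (maxL-allowed m)) (sym (*-suc 2 m)))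

  minL-allowed : ∀ m → minL (allowed (suc m)) ≡ 1
  minL-allowed m = trans (minL-∷ 1 (map-allowed≢[] m))
    (cong (1 ⊓_) (trans (cong minL (map-∘ (allowed m))) (minL-map-suc (map-allowed≢[] m))))

  cost-0⇒∈ : ∀ m k → cost m k ≡ 0 → k ∈ allowed m
  cost-0⇒∈ zero    k e = here e
  cost-0⇒∈ (suc m) (suc zero) e = here refl
  cost-0⇒∈ (suc m) (suc (suc k)) e = there (∈-map⁺ (2 +_) (cost-0⇒∈ m k e))

  ∈⇒cost-0 : ∀ m {k} → k ∈ allowed m → cost m k ≡ 0
  ∈⇒cost-0 zero (here refl) = refl
  ∈⇒cost-0 (suc m) p with p
  ... | here refl = refl
  ... | there q with ∈-map⁻ (2 +_) q
  ...   | k , r , refl = ∈⇒cost-0 m r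

  true-or-false : ∀ t → t ≡ true ⊎ t ≡ false
  true-or-false true  = inj₁ refl
  true-or-false false = inj₂ refl

  2∣⇒half : ∀ {k} → 2 ∣ k → k ≡ 2 * ⌊ k /2⌋
  2∣⇒half (divides q refl) = begin
    q * 2            ≡⟨ *-comm q 2 ⟩
    2 * q            ≡⟨ cong (2 *_) (n≡⌊n+n/2⌋ q) ⟩
    2 * ⌊ q + q /2⌋  ≡⟨ cong (λ k → 2 * ⌊ k /2⌋) (trans (cong (q +_) (sym (+-identityʳ q))) (*-comm 2 q)) ⟩
    2 * ⌊ q * 2 /2⌋  ∎
    where open ≡-Reasoning

-- The decomposition for `Hf f` and the three claims

module _ {n} (G : Graph n) (f : Fin n → ℕ) (f-even : ∀ v → 2 ∣ f v) (f≥4 : ∀ v → 4 ≤ f v) where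

  private
    half : Vector ℕ n
    half v = ⌊ f v /2⌋

    Hf-allowed : ∀ v → Hf f v ≡ allowed (half v)
    Hf-allowed v = trans (cong (λ k → odds (half v) ++ (k ∷ [])) (2∣⇒half (f-even v))) (odds-allowed (half v))

    half-suc : ∀ v → half v ≡ suc (pred (half v))
    half-suc v = sym (suc-pred (half v) {{>-nonZero (≤-trans (s≤s z≤n) (⌊n/2⌋-mono (f≥4 v)))}})

    nabla-total : ∀ (F : Spanning G) → nabla (Hf f) F ≡ total half (deg F)
    nabla-total F = trans (sum-map-allFin (λ v → distTo (deg F v) (Hf f v)))
      (sum-cong-≗ (λ v → trans (cong (distTo (deg F v)) (Hf-allowed v)) (distTo-allowed (half v) (deg F v))))

    optimal⇒opt : ∀ (F : Spanning G) → Optimal G (Hf f) F → Opt half F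
    optimal⇒opt F o F' = subst₂ _≤_ (nabla-total F) (nabla-total F') (o F')

    opt⇒optimal : ∀ (F : Spanning G) → Opt half F → Optimal G (Hf f) F
    opt⇒optimal F o F' = subst₂ _≤_ (sym (nabla-total F)) (sym (nabla-total F')) (o F')

    C⇒no-defect : ∀ {v} → InC G (Hf f) v → ∀ (F : Spanning G) → Opt half F → cost (half v) (deg F v) ≡ 0
    C⇒no-defect {v} p F o = ∈⇒cost-0 (half v)
      (subst (deg F v ∈_) (Hf-allowed v) (p (deg F v) (F , opt⇒optimal F o , refl)))

    -- Used contrapositively: when a contradiction is the goal, a vertex outside `C` may be taken as
    -- a defect of some optimal subgraph.
    no-defect⇒C : ∀ {v} → (∀ (F : Spanning G) → Opt half F → ¬ Defect half F v) → InC G (Hf f) v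
    no-defect⇒C {v} p k (F , o , refl) = subst (deg F v ∈_) (sym (Hf-allowed v))
      (cost-0⇒∈ (half v) (deg F v) (decidable-stable (cost (half v) (deg F v) ≟ℕ 0) (p F (optimal⇒opt F o))))

    A⇒high : ∀ {v} → InA G (Hf f) v → ∀ (F : Spanning G) → Opt half F → low (half v) (deg F v) ≡ false
    A⇒high {v} (_ , p) F o = ¬-not (λ l → <⇒≱ (low⇒< (half v) (deg F v) l)
      (subst (_≤ deg F v) (trans (cong maxL (Hf-allowed v)) (maxL-allowed (half v)))
        (p (deg F v) (F , opt⇒optimal F o , refl))))

    high⇒A : ∀ {v} → ¬ InC G (Hf f) v →
      (∀ (F : Spanning G) → Opt half F → low (half v) (deg F v) ≢ true) → InA G (Hf f) v
    high⇒A {v} ¬C p = ¬C , λ { k (F , o , refl) →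
      subst (_≤ deg F v) (sym (trans (cong maxL (Hf-allowed v)) (maxL-allowed (half v))))
        (high⇒≥ (half v) (deg F v) (¬-not (p F (optimal⇒opt F o)))) }

    B⇒≤1 : ∀ {v} → InB G (Hf f) v → ∀ (F : Spanning G) → Opt half F → deg F v ≤ 1
    B⇒≤1 {v} (_ , p) F o = subst (deg F v ≤_)
      (trans (cong minL (trans (Hf-allowed v) (cong allowed (half-suc v)))) (minL-allowed (pred (half v))))
      (p (deg F v) (F , opt⇒optimal F o , refl))

    low-≤1 : ∀ {v k} → k ≤ 1 → low (half v) k ≡ true
    low-≤1 {v} z≤n       rewrite half-suc v = refl
    low-≤1 {v} (s≤s z≤n) rewrite half-suc v = refl

    cost-1 : ∀ v → cost (half v) 1 ≡ 0
    cost-1 v rewrite half-suc v = refl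

    B⇒Low : ∀ {v} → InB G (Hf f) v → Low {G = G} half v
    B⇒Low {v} B F o = low-≤1 {v} (B⇒≤1 B F o)

    -- Let `v` be high in `F`, and let `F₁` have a defect at `v`. By `no-crossing`, `F₁` is high at
    -- `v`, and then so is every optimal subgraph, which would put `v` into `A`.
    D⇒Low : ∀ {v} → InD G (Hf f) v → Low {G = G} half v
    D⇒Low {v} (¬A , ¬B , ¬C) F o = ¬-not λ h → ¬C (no-defect⇒C λ F₁ o₁ c₁ →
      let F₁-high = ¬-not λ l → no-crossing half v F₁ F (o₁ , o , c₁ , λ e → true≢false l (trans e h))
      in ¬A (high⇒A ¬C λ F₀ o₀ l₀ →
           no-crossing half v F₁ F₀ (o₁ , o₀ , c₁ , λ e → true≢false l₀ (trans (sym e) F₁-high))))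

    module _ (F : Spanning G) (o : Opt half F) {u : Fin n} (c : Defect half F u) (u-low : Low {G = G} half u)
             {w : Fin n} (p : adj G u w ≡ true) where

      F₁ : Spanning G
      F₁ = flip F u w p

      passed : Opt half F₁ × cost (half w) (deg F₁ w) ≡ suc (cost (half w) (deg F w))
      passed = pass-defect half F u w p o c (u-low F o)

      far-add : sub F u w ≡ false → deg F₁ w ≡ suc (deg F w)
      far-add e = trans (deg-flip-swap F u w p (trans (Graph.sym G w u) p) w)
        (deg-flip-add F w u (trans (Graph.sym G w u) p) (trans (subSym F w u) e))

      far-remove : sub F u w ≡ true → deg F w ≡ suc (deg F₁ w)
      far-remove e = trans (deg-flip-remove F w u (trans (Graph.sym G w u) p) (trans (subSym F w u) e))
        (cong suc (sym (deg-flip-swap F u w p (trans (Graph.sym G w u) p) w)))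

      neighbour-∉C : ¬ InC G (Hf f) w
      neighbour-∉C C = 0≢1+n (trans (sym (C⇒no-defect C F₁ (proj₁ passed))) (proj₂ passed))

      -- Were `uw` in `F`, the flip would lower a degree that stays at least `f w`, which gains at
      -- `w`; but passing the defect loses there.
      neighbour-∈A : InA G (Hf f) w → sub F u w ≡ false
      neighbour-∈A A = ¬-not λ e → m≢1+n+m (cost (half w) (deg F₁ w)) {1} (begin
        cost (half w) (deg F₁ w)              ≡⟨ proj₂ passed ⟩
        suc (cost (half w) (deg F w))         ≡⟨ cong (suc ∘ cost (half w)) (far-remove e) ⟩
        suc (cost (half w) (suc (deg F₁ w)))  ≡⟨ cong suc (high-up (half w) _ (A⇒high A F₁ (proj₁ passed))) ⟩
        2 + cost (half w) (deg F₁ w)          ∎)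
        where open ≡-Reasoning

      -- Were `uw` missing, the flip would raise the degree of `w` to exactly one, where there is no
      -- defect.
      neighbour-∈B : InB G (Hf f) w → sub F u w ≡ true
      neighbour-∈B B = ¬-not λ e → 0≢1+n (begin
        0                              ≡⟨ sym (cost-1 w) ⟩
        cost (half w) 1                ≡⟨ cong (cost (half w)) (sym (F₁-w e)) ⟩
        cost (half w) (deg F₁ w)       ≡⟨ proj₂ passed ⟩
        suc (cost (half w) (deg F w))  ∎)
        where
        open ≡-Reasoning
        F₁-w : sub F u w ≡ false → deg F₁ w ≡ 1
        F₁-w e = ≤-antisym (B⇒≤1 B F₁ (proj₁ passed)) (≤-trans (s≤s z≤n) (≤-reflexive (sym (far-add e))))

      neighbour-outside : ¬ InB G (Hf f) w → ¬ InD G (Hf f) w → sub F u w ≡ false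
      neighbour-outside ¬B ¬D = ¬-not λ e →
        ¬D ((λ A → true≢false e (neighbour-∈A A)) , ¬B , neighbour-∉C)

  -- If `u` is a defect, `w` is not in `C`; and if `w` is in `B`, the edge is present, so `u` has
  -- degree exactly one and is no defect after all. Hence `u` would lie in `C`.
  B-isolated : ∀ u w → InB G (Hf f) u → (InB G (Hf f) w ⊎ InC G (Hf f) w) → ¬ (adj G u w ≡ true)
  B-isolated u w B BC p = proj₁ B (no-defect⇒C λ F o c → case BC F o c)
    where
    case : InB G (Hf f) w ⊎ InC G (Hf f) w → ∀ F → Opt half F → Defect half F u → ⊥
    case (inj₂ C) F o c = neighbour-∉C F o c (B⇒Low B) p C
    case (inj₁ B') F o c = c (trans (cong (cost (half u)) deg-1) (cost-1 u))
      where
      deg-1 : deg F u ≡ 1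
      deg-1 = ≤-antisym (B⇒≤1 B F o) (≤-trans (s≤s z≤n) (≤-reflexive (sym
        (deg-flip-remove F u w p (neighbour-∈B F o c (B⇒Low B) p B')))))

  module _ (b d : Fin n → Bool)
    (b⇔ : ∀ v → (b v ≡ true) ⇔ InB G (Hf f) v) (d⇔ : ∀ v → (d v ≡ true) ⇔ InD G (Hf f) v) where

    private
      open Equivalence

      b⇒Low : ∀ {v} → b v ≡ true → Low {G = G} half v
      b⇒Low {v} p = B⇒Low (to (b⇔ v) p)

      d⇒Low : ∀ {v} → d v ≡ true → Low {G = G} half v
      d⇒Low {v} p = D⇒Low (to (d⇔ v) p)

    -- Common form of (b) and (c): `S` is `D` with `T` equal to `B`, or `S` is the union of `D` and
    -- `B` with `T` empty.
    component-parity : ∀ S R T → IsComponent G S R →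
      (∀ v → S v ≡ true → b v ≡ true ⊎ d v ≡ true) →
      (∀ w → S w ≡ true → T w ≡ false) → (∀ w → T w ≡ true → b w ≡ true) →
      (∀ w → S w ≡ false → T w ≡ false → b w ≡ false × d w ≡ false) →
      (count R + edgesBetween G R T) % 2 ≡ 1
    component-parity S R T (R⊆S , (v , Rv) , connected , closed) S⊆ T-off T⊆b outside =
      -- An optimal subgraph with a defect at `v` is at hand only under a double negation, which the
      -- decidable equation absorbs.
      decidable-stable (_ ≟ℕ 1) λ ¬odd → ∉C (S⊆ v (R⊆S v Rv)) (no-defect⇒C λ F o c →
        ¬odd (region-parity half R R-low T (λ w Rw → T-off w (R⊆S w Rw)) boundary connected v Rv F o c))
      where
      ∉C : ∀ {v} → b v ≡ true ⊎ d v ≡ true → ¬ InC G (Hf f) v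
      ∉C {v} (inj₁ p) = proj₁ (to (b⇔ v) p)
      ∉C {v} (inj₂ p) = proj₂ (proj₂ (to (d⇔ v) p))

      R-low : ∀ u → R u ≡ true → Low half u
      R-low u Ru = [ b⇒Low , d⇒Low ]′ (S⊆ u (R⊆S u Ru))

      boundary : ∀ F → Opt half F → ∀ u w → Defect half F u → R u ≡ true → R w ≡ false →
                 sub F u w ≡ T w ∧ adj G u w
      boundary F o u w c Ru Rw with true-or-false (adj G u w)
      ... | inj₂ ¬p rewrite ¬p | ∧-zeroʳ (T w) = ¬-not λ e → true≢false (subAdj F u w e) ¬p
      ... | inj₁ p rewrite p | ∧-identityʳ (T w) with true-or-false (T w)
      ...   | inj₁ Tw = trans (neighbour-∈B F o c (R-low u Ru) p (to (b⇔ w) (T⊆b w Tw))) (sym Tw)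
      ...   | inj₂ ¬Tw = trans (neighbour-outside F o c (R-low u Ru) p
                (λ B → true≢false (from (b⇔ w) B) (proj₁ out)) (λ D → true≢false (from (d⇔ w) D) (proj₂ out))) (sym ¬Tw)
        where
        out : b w ≡ false × d w ≡ false
        -- A neighbour of the component outside `R` is outside `S`, since components are closed.
        out = outside w (¬-not λ Sw → true≢false (closed u w Ru Sw p) Rw) ¬Tw

    D-component-parity : ∀ R → IsComponent G d R → (count R + edgesBetween G R b) % 2 ≡ 1
    D-component-parity R comp = component-parity d R b comp (λ _ → inj₂)
      (λ w dw → ¬-not λ bw → proj₁ (proj₂ (to (d⇔ w) dw)) (to (b⇔ w) bw))
      (λ _ bw → bw) (λ _ dw bw → bw , dw)

    DB-component-odd : ∀ R → IsComponent G (λ v → d v ∨ b v) R → count R % 2 ≡ 1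
    DB-component-odd R comp = trans (cong (_% 2) (sym no-edges))
      (component-parity (λ v → d v ∨ b v) R (λ _ → false) comp split (λ _ _ → refl) (λ _ ()) join)
      where
      split : ∀ v → d v ∨ b v ≡ true → b v ≡ true ⊎ d v ≡ true
      split v p with d v
      ... | true  = inj₂ refl
      ... | false = inj₁ p
      join : ∀ w → d w ∨ b w ≡ false → false ≡ false → b w ≡ false × d w ≡ false
      join w p _ with d w
      ... | false = p , refl
      no-edges : count R + edgesBetween G R (λ _ → false) ≡ count R
      no-edges = trans (cong (count R +_) (trans (sum-map-allFin
        (λ u → if R u then count {n} (λ _ → false) else 0)) (∑-zero row))) (+-identityʳ (count R))
        where
        row : ∀ u → (if R u then count {n} (λ _ → false) else 0) ≡ 0
        row u with R u
        ... | true  = trans (count-∑ {n} (λ _ → false)) (∑-zero {n} (λ _ → refl))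
        ... | false = refl

theorem8 : (n : ℕ) (G : Graph n) (f : Fin n → ℕ)
    → (∀ v → 2 ∣ f v) → (∀ v → 4 ≤ f v)
    → (b d : Fin n → Bool)
    → (∀ v → (b v ≡ true) ⇔ InB G (Hf f) v)
    → (∀ v → (d v ≡ true) ⇔ InD G (Hf f) v)
    → ((∀ u w → InB G (Hf f) u → (InB G (Hf f) w ⊎ InC G (Hf f) w) → ¬ (adj G u w ≡ true))
    × (∀ R → IsComponent G d R → (count R + edgesBetween G R b) % 2 ≡ 1)
    × (∀ R → IsComponent G (λ v → d v ∨ b v) R → count R % 2 ≡ 1))
theorem8 n G f f-even f≥4 b d b⇔ d⇔ =
  B-isolated G f f-even f≥4 ,
  D-component-parity G f f-even f≥4 b d b⇔ d⇔ ,
  DB-component-odd G f f-even f≥4 b d b⇔ d⇔
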